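{- Let $\mathcal{A}$ be a finite alphabet with $|\mathcal{A}|\ge 4$. Then Ann has a winning strategy in the nonrepetitive game over $\mathcal{A}$: she has a strategy such that, whatever letters Ben plays, the shared word never contains a square of period at least $2$ as a factor, so the game continues forever.
   Context: A square is a word of the form $uu$ with $u$ a non-empty word; its period is $|u|$. The nonrepetitive game over an alphabet $\mathcal{A}$ is played by Ann and Ben, who, starting from the empty word, alternately append one letter of $\mathcal{A}$ to the end of a shared word, Ann playing first. Ben wins as soon as the shared word contains a factor that is a square of period at least $2$ (squares of period $1$, i.e. $aa$, are allowed). Ann wins if this never happens, i.e. if she can build arbitrarily long words. -}

module Defs where

open import Data.Nat using (ℕ; _≤_)
open import Data.List using (List; []; _∷_; _++_; [_]; length)
open import Data.Product using (∃-syntax; _×_)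
open import Data.Sum using (_⊎_)
open import Relation.Nullary using (¬_)
open import Relation.Binary.PropositionalEquality using (_≡_)

HasSquareFactor≥2 : {A : Set} → List A → Set
HasSquareFactor≥2 w =
  ∃[ x ] ∃[ u ] ∃[ y ] (2 ≤ length u × w ≡ x ++ (u ++ (u ++ y)))

AnnStrategy : Set → Set
AnnStrategy A = List A → A

data AnnTurn {A : Set} (σ : AnnStrategy A) : List A → Set
data BenTurn {A : Set} (σ : AnnStrategy A) : List A → Set

data AnnTurn {A} σ where
  start   : AnnTurn σ []
  benMove : ∀ {w} → BenTurn σ w → (b : A) → AnnTurn σ (w ++ [ b ])

data BenTurn {A} σ where
  annMove : ∀ {w} → AnnTurn σ w → BenTurn σ (w ++ [ σ w ])

Reachable : {A : Set} → AnnStrategy A → List A → Set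
Reachable σ w = AnnTurn σ w ⊎ BenTurn σ w

AnnWins : Set → Set
AnnWins A = ∃[ σ ] ((w : List A) → Reachable {A} σ w → ¬ HasSquareFactor≥2 w)

{-# OPTIONS --safe #-}
module Submission where

-- If Ann never creates a word whose last p - 1 letters repeat those p places earlier, for some
-- p ≥ 2, then no square of period ≥ 2 ever appears: a square completed by Ann has this property,
-- and one completed by Ben had it just before his move. Reading the history h backwards, Ann
-- keeps threat h < capacity h. The capacity is at most 722, depends on a bounded number of
-- letters up to renaming, vanishes when some p ≤ 7 is violated, and for each letter b of Ben
-- satisfies 3 * capacity h + 720 ≤ 2 * Σ capacity (a b h), summed over certain distinct letters a
-- other than the last letter of Ann. The threat is a sum over the periods p ≥ 8 of dangers which
-- grow by a factor 3/2 with every further round of repetition and reach 722 when the period is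
-- violated. Each danger grows for one letter a only and three consecutive periods cannot start
-- growing together, so Σ threat (a b h) ≤ 3/2 * threat h + 360 and some answer a is good.

open import Defs
import Data.Integer as ℤ
open import Data.Bool using (Bool; true; false; T; if_then_else_; _∧_; _∨_)
open import Data.Bool.Properties using (T-∧; T-∨)
open import Data.Fin using (Fin; toℕ; fromℕ<)
open import Data.Fin.Properties using (toℕ-fromℕ<)
open import Data.List using (List; []; _∷_; _++_; drop; head; length; map; reverse; upTo; initLast; _∷ʳ′_)
open import Data.List.Membership.Propositional using (_∈_)
open import Data.List.Membership.Propositional.Properties using (∈-upTo⁺; ∈-upTo⁻)
open import Data.List.Properties
  using (++-assoc; map-++; map-∘; map-cong; map-id-local; length-++; length-map; length-reverse;
         reverse-++; drop-map; drop-drop; ∷-injectiveʳ)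
open import Data.List.Relation.Unary.All as All using (All; []; _∷_)
import Data.List.Relation.Unary.All.Properties as All
open import Data.List.Relation.Unary.AllPairs using ([]; _∷_)
open import Data.List.Relation.Unary.Any using (here; there)
open import Data.List.Relation.Unary.Unique.Propositional using (Unique)
import Data.List.Relation.Unary.Unique.Propositional.Properties as Unique
open import Data.Maybe as Maybe using (Maybe; just; nothing; fromMaybe)
open import Data.Nat as ℕ using (ℕ; zero; suc; z≤n; s≤s; ⌊_/2⌋)
import Data.Nat.Properties as ℕ
open import Data.Nat.ListAction using (sum)
open import Data.Product using (_×_; _,_; ∃-syntax)
open import Data.Sum using (inj₁; inj₂)
open import Data.Unit using (tt)
open import Function using (_∘_; Equivalence)
open import Function.Definitions using (Injective)
open import Relation.Binary.PropositionalEquality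
open import Relation.Nullary using (Dec; yes; no; does; ¬_; contradiction)
open import Relation.Nullary.Decidable using (_×-dec_; from-yes; dec-true; dec-false)

-- Dangers of the periods from 8 on.

module Threat where

  open import Data.Rational using (ℚ; 0ℚ; ½; _/_; _+_; _*_; _≤_; NonNegative)
  open import Data.Rational.Properties
  open import Data.Rational.Solver using (module +-*-Solver)
  open +-*-Solver using (solve; _:=_; _:+_; _:*_; con)

  ⅔ 1½ : ℚ
  ⅔ = ℤ.+ 2 / 3
  1½ = ℤ.+ 3 / 2

  -- A violation takes one more round for every two further periods; the decay by ⅔ offsets the
  -- factor 3/2 of that round.
  weight : ℕ → ℚ
  weight 0 = ℤ.+ 304 / 1
  weight 1 = ℤ.+ 304 / 1
  weight (suc (suc n)) = ⅔ * weight n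

  -- danger n r = weight n * ((3/2)^r - 1): the danger of period n + 8 after r matched rounds.
  danger : ℕ → ℕ → ℚ
  danger n zero = 0ℚ
  danger n (suc r) = 1½ * danger n r + ½ * weight n

  -- Bounds the sum of ½ * weight m over any set of m ≥ n with no two elements closer than 3.
  budget : ℕ → ℚ
  budget 0 = ℤ.+ 360 / 1
  budget 1 = ℤ.+ 312 / 1
  budget (suc (suc n)) = ⅔ * budget n

  *-≥0 : ∀ r .{{_ : NonNegative r}} {p} → 0ℚ ≤ p → 0ℚ ≤ r * p
  *-≥0 r {p} 0≤p = subst (_≤ r * p) (*-zeroʳ r) (*-monoˡ-≤-nonNeg r 0≤p)

  +-≥0 : ∀ {p q} → 0ℚ ≤ p → 0ℚ ≤ q → 0ℚ ≤ p + q
  +-≥0 = +-mono-≤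

  ≤-+ʳ : ∀ {p q} → 0ℚ ≤ q → p ≤ p + q
  ≤-+ʳ {p} {q} 0≤q = subst (_≤ p + q) (+-identityʳ p) (+-monoʳ-≤ p 0≤q)

  ≤-+ˡ : ∀ {p q} → 0ℚ ≤ p → q ≤ p + q
  ≤-+ˡ {p} {q} 0≤p = subst (_≤ p + q) (+-identityˡ q) (+-monoˡ-≤ q 0≤p)

  weight≥0 : ∀ n → 0ℚ ≤ weight n
  weight≥0 0 = from-yes (0ℚ ≤? weight 0)
  weight≥0 1 = from-yes (0ℚ ≤? weight 1)
  weight≥0 (suc (suc n)) = *-≥0 ⅔ (weight≥0 n)

  weight≤304 : ∀ n → weight n ≤ ℤ.+ 304 / 1
  weight≤304 0 = ≤-refl
  weight≤304 1 = ≤-refl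
  weight≤304 (suc (suc n)) =
    ≤-trans (*-monoˡ-≤-nonNeg ⅔ (weight≤304 n)) (from-yes (⅔ * weight 0 ≤? weight 0))

  budget≥0 : ∀ n → 0ℚ ≤ budget n
  budget≥0 0 = from-yes (0ℚ ≤? budget 0)
  budget≥0 1 = from-yes (0ℚ ≤? budget 1)
  budget≥0 (suc (suc n)) = *-≥0 ⅔ (budget≥0 n)

  budget-antitone : ∀ n → budget (suc n) ≤ budget n
  budget-antitone 0 = from-yes (budget 1 ≤? budget 0)
  budget-antitone 1 = from-yes (budget 2 ≤? budget 1)
  budget-antitone (suc (suc n)) = *-monoˡ-≤-nonNeg ⅔ (budget-antitone n)

  -- In fact an equality: 360 and 312 solve 152 + ⅔ * 312 = 360 and 152 + 4/9 * 360 = 312, where 152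
  -- = ½ * 304. Scaling by ⅔ gives the rest.
  budget-charge : ∀ n → ½ * weight n + budget (3 ℕ.+ n) ≤ budget n
  budget-charge 0 = from-yes (½ * weight 0 + budget 3 ≤? budget 0)
  budget-charge 1 = from-yes (½ * weight 1 + budget 4 ≤? budget 1)
  budget-charge (suc (suc n)) =
    subst (_≤ ⅔ * budget n)
      (solve 3 (λ w b k → k :* (con ½ :* w :+ b) := con ½ :* (k :* w) :+ k :* b) refl
        (weight n) (budget (3 ℕ.+ n)) ⅔)
      (*-monoˡ-≤-nonNeg ⅔ (budget-charge n))

  danger≥0 : ∀ n r → 0ℚ ≤ danger n r
  danger≥0 n zero = ≤-refl
  danger≥0 n (suc r) = +-≥0 (*-≥0 1½ (danger≥0 n r)) (*-≥0 ½ (weight≥0 n))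

  danger-mono : ∀ n {r s} → r ℕ.≤ s → danger n r ≤ danger n s
  danger-mono n {s = s} z≤n = danger≥0 n s
  danger-mono n (s≤s r≤s) = +-monoˡ-≤ (½ * weight n) (*-monoˡ-≤-nonNeg 1½ (danger-mono n r≤s))

  danger-scale : ∀ n r → danger (2 ℕ.+ n) r ≡ ⅔ * danger n r
  danger-scale n zero = refl
  danger-scale n (suc r) = begin
    1½ * danger (2 ℕ.+ n) r + ½ * (⅔ * weight n) ≡⟨ cong (λ d → 1½ * d + ½ * (⅔ * weight n)) (danger-scale n r) ⟩
    1½ * (⅔ * danger n r) + ½ * (⅔ * weight n)
      ≡⟨ solve 3 (λ d w k → con 1½ :* (k :* d) :+ con ½ :* (k :* w) := k :* (con 1½ :* d :+ con ½ :* w)) refl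
           (danger n r) (weight n) ⅔ ⟩
    ⅔ * danger n (suc r) ∎
    where open ≡-Reasoning

  -- The sum is `weight n` times (3/2)^(3 + ⌊ n /2⌋). The powers of ⅔ in the weight cancel all but
  -- three factors: 304 * 27/8 = 1026.
  danger+weight : ∀ n → danger n (3 ℕ.+ ⌊ n /2⌋) + weight n ≡ ℤ.+ 1026 / 1
  danger+weight 0 = refl
  danger+weight 1 = refl
  danger+weight (suc (suc n)) = begin
    1½ * danger (2 ℕ.+ n) r + ½ * (⅔ * weight n) + ⅔ * weight n
      ≡⟨ cong (λ d → 1½ * d + ½ * (⅔ * weight n) + ⅔ * weight n) (danger-scale n r) ⟩
    1½ * (⅔ * danger n r) + ½ * (⅔ * weight n) + ⅔ * weight n
      ≡⟨ solve 2 (λ d w → con 1½ :* (con ⅔ :* d) :+ con ½ :* (con ⅔ :* w) :+ con ⅔ :* w := d :+ w) refl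
           (danger n r) (weight n) ⟩
    danger n r + weight n ≡⟨ danger+weight n ⟩
    ℤ.+ 1026 / 1 ∎
    where
    open ≡-Reasoning
    r = 3 ℕ.+ ⌊ n /2⌋

  -- Violating period `n + 8` means repeating `n + 7` letters, hence `3 + ⌊ n /2⌋` rounds. Taking a
  -- weight of at most 304 from 1026 leaves 722, the ceiling of the capacities.
  danger-complete : ∀ n → ℤ.+ 722 / 1 ≤ danger n (3 ℕ.+ ⌊ n /2⌋)
  danger-complete n = +-cancelʳ-≤′ (weight n)
    (subst (ℤ.+ 722 / 1 + weight n ≤_) (sym (danger+weight n)) (+-monoʳ-≤ (ℤ.+ 722 / 1) (weight≤304 n)))
    where
    +-cancelʳ-≤′ : ∀ r {p q} → p + r ≤ q + r → p ≤ q
    +-cancelʳ-≤′ r {p} {q} le = ≮⇒≥ λ q<p → <-irrefl refl (<-≤-trans (+-monoˡ-< r q<p) le)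

  -- Sums over letters.

  total : List ℕ → (ℕ → ℚ) → ℚ
  total [] f = 0ℚ
  total (a ∷ as) f = f a + total as f

  total-0 : ∀ as f → (∀ {a} → a ∈ as → f a ≡ 0ℚ) → total as f ≡ 0ℚ
  total-0 [] f _ = refl
  total-0 (a ∷ as) f f≡0 = cong₂ _+_ (f≡0 (here refl)) (total-0 as f (λ a∈ → f≡0 (there a∈)))

  total-+ : ∀ as f g → total as (λ a → f a + g a) ≡ total as f + total as g
  total-+ [] f g = refl
  total-+ (a ∷ as) f g = trans (cong (λ t → (f a + g a) + t) (total-+ as f g))
    (solve 4 (λ x y s t → (x :+ y) :+ (s :+ t) := (x :+ s) :+ (y :+ t)) refl
      (f a) (g a) (total as f) (total as g))

  total-+0 : ∀ as f g → (∀ {a} → a ∈ as → f a ≡ 0ℚ) → total as (λ a → f a + g a) ≡ total as g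
  total-+0 as f g f≡0 = trans (total-+ as f g)
    (trans (cong (_+ total as g) (total-0 as f f≡0)) (+-identityˡ (total as g)))

  total-single : ∀ {as p} f y → Unique as → 0ℚ ≤ p → f y ≤ p →
                 (∀ {a} → a ∈ as → a ≢ y → f a ≡ 0ℚ) → total as f ≤ p
  total-single f y [] 0≤p _ _ = 0≤p
  total-single {a ∷ as} {p} f y (a∉ ∷ u) 0≤p fy f≡0 with a ℕ.≟ y
  ... | yes refl = subst (_≤ p) (sym (trans (cong (λ t → f a + t) (total-0 as f rest)) (+-identityʳ (f a)))) fy
    where
    rest : ∀ {a′} → a′ ∈ as → f a′ ≡ 0ℚ
    rest a′∈ = f≡0 (there a′∈) (λ eq → All.lookup a∉ a′∈ (sym eq))
  ... | no a≢y = subst (_≤ p) (sym (trans (cong (_+ total as f) (f≡0 (here refl) a≢y)) (+-identityˡ _)))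
    (total-single f y u 0≤p fy (λ a∈ → f≡0 (there a∈)))

  -- Rounds of repetition and the sum of all dangers.

  -- The windows of three letters overlap in one letter, so a common prefix of length p - 1
  -- gives ⌊(p - 2)/2⌋ rounds.
  run : List ℕ → List ℕ → ℕ
  run (a ∷ b ∷ c ∷ h) (y ∷ z ∷ x ∷ g) =
    if does (a ℕ.≟ y ×-dec b ℕ.≟ z ×-dec c ℕ.≟ x) then suc (run (c ∷ h) (x ∷ g)) else 0
  run _ _ = 0

  run-miss : ∀ a b c y z x h g → ¬ (a ≡ y × b ≡ z × c ≡ x) → run (a ∷ b ∷ c ∷ h) (y ∷ z ∷ x ∷ g) ≡ 0
  run-miss a b c y z x h g ¬eqs =
    cong (if_then suc (run (c ∷ h) (x ∷ g)) else 0)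
      (dec-false (a ℕ.≟ y ×-dec b ℕ.≟ z ×-dec c ℕ.≟ x) ¬eqs)

  run-hit : ∀ a b c h g → run (a ∷ b ∷ c ∷ h) (a ∷ b ∷ c ∷ g) ≡ suc (run (c ∷ h) (c ∷ g))
  run-hit a b c h g =
    cong (if_then suc (run (c ∷ h) (c ∷ g)) else 0)
      (dec-true (a ℕ.≟ a ×-dec b ℕ.≟ b ×-dec c ℕ.≟ c) (refl , refl , refl))

  -- In use `s` is `drop (n + 8) h`, so that its tails are the places where the periods `n + 8`,
  -- `n + 9`, ... begin their comparison.
  dangers : ℕ → List ℕ → List ℕ → ℚ
  dangers n h [] = 0ℚ
  dangers n h s@(_ ∷ s′) = danger n (run h s) + dangers (suc n) h s′

  dangers≥0 : ∀ n h s → 0ℚ ≤ dangers n h s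
  dangers≥0 n h [] = ≤-refl
  dangers≥0 n h s@(_ ∷ s′) = +-≥0 (danger≥0 n (run h s)) (dangers≥0 (suc n) h s′)

  run-[] : ∀ h → run h [] ≡ 0
  run-[] [] = refl
  run-[] (_ ∷ []) = refl
  run-[] (_ ∷ _ ∷ []) = refl
  run-[] (_ ∷ _ ∷ _ ∷ _) = refl

  danger≤dangers : ∀ j n h s → danger (j ℕ.+ n) (run h (drop j s)) ≤ dangers n h s
  danger≤dangers zero n h [] rewrite run-[] h = ≤-refl
  danger≤dangers zero n h (x ∷ s) = ≤-+ʳ (dangers≥0 (suc n) h s)
  danger≤dangers (suc j) n h [] rewrite run-[] h = ≤-refl
  danger≤dangers (suc j) n h (x ∷ s) = ≤-trans
    (subst (λ m → danger m (run h (drop j s)) ≤ dangers (suc n) h s) (ℕ.+-suc j n) (danger≤dangers j (suc n) h s))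
    (≤-+ˡ (danger≥0 n (run h (x ∷ s))))

  -- Growth of the dangers in one round of play.

  module _ (b c : ℕ) (h : List ℕ) {as : List ℕ} (c∉as : ¬ (c ∈ as)) (unique : Unique as) where

    private
      h′ : List ℕ
      h′ = c ∷ h

      ext : ℕ → List ℕ
      ext a = a ∷ b ∷ h′

      Drift : ℕ → List ℕ → Set
      Drift n s = total as (λ a → dangers n (ext a) s) ≤ 1½ * dangers n h′ (drop 2 s) + budget n

      short : ∀ n s → total as (λ _ → 0ℚ) ≤ 1½ * dangers n h′ s + budget n
      short n s = subst (_≤ 1½ * dangers n h′ s + budget n) (sym (total-0 as (λ _ → 0ℚ) (λ _ → refl)))
        (+-≥0 (*-≥0 1½ (dangers≥0 n h′ s)) (budget≥0 n))

      -- The mismatch lies in letters fixed before Ann answers, so this period has danger 0 whatever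
      -- `a` is.
      drift-miss : ∀ n y z x g → ¬ (b ≡ z × c ≡ x) → Drift (suc n) (z ∷ x ∷ g) → Drift n (y ∷ z ∷ x ∷ g)
      drift-miss n y z x g ¬hit ih = begin
        total as (λ a → danger n (run (ext a) s) + dangers (suc n) (ext a) s′)
          ≡⟨ total-+0 as (λ a → danger n (run (ext a) s)) (λ a → dangers (suc n) (ext a) s′)
               (λ {a} _ → cong (danger n) (run-miss a b c y z x h g (λ (_ , eqs) → ¬hit eqs))) ⟩
        total as (λ a → dangers (suc n) (ext a) s′)
          ≤⟨ ih ⟩
        1½ * dangers (suc n) h′ g + budget (suc n)
          ≤⟨ +-mono-≤ (*-monoˡ-≤-nonNeg 1½ (≤-+ˡ (danger≥0 n (run h′ (x ∷ g))))) (budget-antitone n) ⟩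
        1½ * dangers n h′ (x ∷ g) + budget n ∎
        where
        open ≤-Reasoning
        s = y ∷ z ∷ x ∷ g
        s′ = z ∷ x ∷ g

      -- A match would need `a ≡ b` and `b ≡ c`.
      skip₁ : ∀ {a} g → a ∈ as → run (ext a) (b ∷ c ∷ g) ≡ 0
      skip₁ [] _ = refl
      skip₁ {a} (x ∷ g) a∈ = run-miss a b c b c x h g λ where (refl , refl , refl) → c∉as a∈

      skip₂ : ∀ {a} g → a ∈ as → run (ext a) (c ∷ g) ≡ 0
      skip₂ [] _ = refl
      skip₂ (_ ∷ []) _ = refl
      skip₂ {a} (z ∷ x ∷ g) a∈ = run-miss a b c c z x h g λ where (refl , _) → c∉as a∈

      dangers-drop₂ : ∀ n g → dangers (2 ℕ.+ n) h′ (drop 2 g) ≤ dangers n h′ g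
      dangers-drop₂ n [] = ≤-refl
      dangers-drop₂ n (u ∷ []) = dangers≥0 n h′ (u ∷ [])
      dangers-drop₂ n (u ∷ v ∷ g) =
        ≤-trans (≤-+ˡ (danger≥0 (suc n) (run h′ (v ∷ g)))) (≤-+ˡ (danger≥0 n (run h′ (u ∷ v ∷ g))))

      -- If period n + 8 gains a round, then the next two periods cannot, because c ∉ as.
      drift-hit : ∀ n y g → Drift (3 ℕ.+ n) g → Drift n (y ∷ b ∷ c ∷ g)
      drift-hit n y g ih = begin
        total as (λ a → d₀ a + (d₁ a + (d₂ a + d₃ a)))
          ≡⟨ total-+ as d₀ (λ a → d₁ a + (d₂ a + d₃ a)) ⟩
        total as d₀ + total as (λ a → d₁ a + (d₂ a + d₃ a))
          ≡⟨ cong (total as d₀ +_) (total-+0 as d₁ (λ a → d₂ a + d₃ a) (λ a∈ → cong (danger (suc n)) (skip₁ g a∈))) ⟩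
        total as d₀ + total as (λ a → d₂ a + d₃ a)
          ≡⟨ cong (total as d₀ +_) (total-+0 as d₂ d₃ (λ a∈ → cong (danger (2 ℕ.+ n)) (skip₂ g a∈))) ⟩
        total as d₀ + total as d₃
          ≤⟨ +-mono-≤ hit ih ⟩
        danger n (suc r) + (1½ * dangers (3 ℕ.+ n) h′ (drop 2 g) + budget (3 ℕ.+ n))
          ≤⟨ +-monoʳ-≤ (danger n (suc r)) (+-monoˡ-≤ (budget (3 ℕ.+ n))
               (*-monoˡ-≤-nonNeg 1½ (dangers-drop₂ (suc n) g))) ⟩
        danger n (suc r) + (1½ * dangers (suc n) h′ g + budget (3 ℕ.+ n))
          ≡⟨ solve 4 (λ d w e t → (con 1½ :* d :+ con ½ :* w) :+ (con 1½ :* e :+ t)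
                                    := con 1½ :* (d :+ e) :+ (con ½ :* w :+ t)) refl
               (danger n r) (weight n) (dangers (suc n) h′ g) (budget (3 ℕ.+ n)) ⟩
        1½ * dangers n h′ (c ∷ g) + (½ * weight n + budget (3 ℕ.+ n))
          ≤⟨ +-monoʳ-≤ (1½ * dangers n h′ (c ∷ g)) (budget-charge n) ⟩
        1½ * dangers n h′ (c ∷ g) + budget n ∎
        where
        open ≤-Reasoning
        r = run h′ (c ∷ g)
        d₀ d₁ d₂ d₃ : ℕ → ℚ
        d₀ a = danger n (run (ext a) (y ∷ b ∷ c ∷ g))
        d₁ a = danger (suc n) (run (ext a) (b ∷ c ∷ g))
        d₂ a = danger (2 ℕ.+ n) (run (ext a) (c ∷ g))
        d₃ a = dangers (3 ℕ.+ n) (ext a) g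

        -- Only the answer `y` prolongs the repetition; any other resets this danger to 0.
        hit : total as d₀ ≤ danger n (suc r)
        hit = total-single d₀ y unique (danger≥0 n (suc r))
          (≤-reflexive (cong (danger n) (run-hit y b c h g)))
          (λ {a} _ a≢y → cong (danger n) (run-miss a b c y b c h g (λ (a≡y , _) → a≢y a≡y)))

      drift-step : ∀ n y z x g → Drift (suc n) (z ∷ x ∷ g) → Drift (3 ℕ.+ n) g → Drift n (y ∷ z ∷ x ∷ g)
      drift-step n y z x g ih₁ ih₃ with b ℕ.≟ z ×-dec c ℕ.≟ x
      ... | no ¬hit = drift-miss n y z x g ¬hit ih₁
      ... | yes (refl , refl) = drift-hit n y g ih₃

    -- `drop 2 s` is the place of the same period before the round. Periods without a possible gain
    -- are passed one at a time; after a gain the induction jumps by three, which `budget-charge`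
    -- pays for.
    dangers-drift : ∀ n s → total as (λ a → dangers n (a ∷ b ∷ c ∷ h) s)
                            ≤ 1½ * dangers n (c ∷ h) (drop 2 s) + budget n
    dangers-drift n [] = short n []
    dangers-drift n (y ∷ []) = short n []
    dangers-drift n (y ∷ z ∷ []) = short n []
    dangers-drift n (y ∷ z ∷ x ∷ g) =
      drift-step n y z x g (dangers-drift (suc n) (z ∷ x ∷ g)) (dangers-drift (3 ℕ.+ n) g)

  threat : List ℕ → ℚ
  threat h = dangers 0 h (drop 8 h)

  threat-drift : ∀ b c h {as} → ¬ (c ∈ as) → Unique as →
                 total as (λ a → threat (a ∷ b ∷ c ∷ h)) ≤ 1½ * threat (c ∷ h) + (ℤ.+ 360 / 1)
  threat-drift b c h {as} c∉ u =
    -- Dropping 8 letters of `a ∷ b ∷ c ∷ h` leaves `drop 5 h`; dropping 2 more leaves `drop 7 h`,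
    -- that is `drop 8 (c ∷ h)`.
    subst (λ g → total as (λ a → threat (a ∷ b ∷ c ∷ h)) ≤ 1½ * dangers 0 (c ∷ h) g + (ℤ.+ 360 / 1))
      (drop-drop 5 2 h) (dangers-drift b c h c∉ u 0 (drop 5 h))

-- Capacities from a decision tree.

module Certificate where

  open import Data.Nat
  open import Data.Nat.Properties

  -- leaf d stands for the capacity 722 ∸ d, so that capacities are bounded by 722.
  data Tree : Set where
    leaf : ℕ → Tree
    node : List Tree → Tree

  -- Letters are renamed by order of first occurrence: the second argument lists the distinct
  -- letters met so far. The answer is nothing when the word ends before a leaf is reached.
  lookupTree : Tree → List ℕ → List ℕ → Maybe ℕ
  branch : List Tree → List ℕ → List ℕ → ℕ → List ℕ → Maybe ℕ

  lookupTree (leaf d) e h = just (722 ∸ d)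
  lookupTree (node ts) e [] = nothing
  lookupTree (node ts) e (x ∷ h) = branch ts e e x h

  branch [] _ _ _ _ = nothing
  branch (t ∷ ts) [] e x h = lookupTree t (e ++ x ∷ []) h
  branch (t ∷ ts) (y ∷ ys) e x h = if x ≡ᵇ y then lookupTree t e h else branch ts ys e x h

  -- `open-ended` marks words too short to decide, so that every decided value stays valid for all
  -- longer pasts.
  data Verdict : Set where
    agree differ open-ended : Verdict

  match : ℕ → List ℕ → List ℕ → Verdict
  match zero _ _ = agree
  match (suc n) (x ∷ h) (y ∷ g) = if x ≡ᵇ y then match n h g else differ
  match (suc n) _ _ = open-ended

  -- An entry p of the second argument stands for the period p + 1.
  screen : (List ℕ → Maybe ℕ) → List ℕ → List ℕ → Maybe ℕ
  resolve : Verdict → Maybe ℕ → Maybe ℕ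
  resolve agree _ = just 0
  resolve differ r = r
  resolve open-ended _ = nothing

  screen f [] h = f h
  screen f (p ∷ ps) h = resolve (match p h (drop (suc p) h)) (screen f ps h)

  -- Invariance under renaming of letters.

  ≡ᵇ-injective : ∀ {ρ} → Injective _≡_ _≡_ ρ → ∀ x y → (ρ x ≡ᵇ ρ y) ≡ (x ≡ᵇ y)
  ≡ᵇ-injective {ρ} inj x y with x ≟ y
  ... | yes refl = trans (dec-true (ρ x ≟ ρ x) refl) (sym (dec-true (x ≟ x) refl))
  ... | no x≢y = trans (dec-false (ρ x ≟ ρ y) (x≢y ∘ inj)) (sym (dec-false (x ≟ y) x≢y))

  module _ {ρ : ℕ → ℕ} (inj : Injective _≡_ _≡_ ρ) where

    lookupTree-map : ∀ t e h → lookupTree t (map ρ e) (map ρ h) ≡ lookupTree t e h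
    branch-map : ∀ ts ys e x h → branch ts (map ρ ys) (map ρ e) (ρ x) (map ρ h) ≡ branch ts ys e x h

    lookupTree-map (leaf d) e h = refl
    lookupTree-map (node ts) e [] = refl
    lookupTree-map (node ts) e (x ∷ h) = branch-map ts e e x h

    branch-map [] ys e x h = refl
    branch-map (t ∷ ts) [] e x h =
      trans (cong (λ e′ → lookupTree t e′ (map ρ h)) (sym (map-++ ρ e (x ∷ [])))) (lookupTree-map t (e ++ x ∷ []) h)
    branch-map (t ∷ ts) (y ∷ ys) e x h rewrite ≡ᵇ-injective inj x y | lookupTree-map t e h | branch-map ts ys e x h = refl

    match-map : ∀ n h g → match n (map ρ h) (map ρ g) ≡ match n h g
    match-map zero h g = refl
    match-map (suc n) [] g = refl
    match-map (suc n) (x ∷ h) [] = refl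
    match-map (suc n) (x ∷ h) (y ∷ g) rewrite ≡ᵇ-injective inj x y | match-map n h g = refl

    screen-map : ∀ f ps h → f (map ρ h) ≡ f h → screen f ps (map ρ h) ≡ screen f ps h
    screen-map f [] h eq = eq
    screen-map f (p ∷ ps) h eq
      rewrite drop-map {f = ρ} (suc p) h | match-map p h (drop (suc p) h) | screen-map f ps h eq = refl

  -- Stability under extension into the past, and bounds.

  lookupTree-++ : ∀ t e h v {n} → lookupTree t e h ≡ just n → lookupTree t e (h ++ v) ≡ just n
  branch-++ : ∀ ts ys e x h v {n} → branch ts ys e x h ≡ just n → branch ts ys e x (h ++ v) ≡ just n

  lookupTree-++ (leaf d) e h v eq = eq
  lookupTree-++ (node ts) e (x ∷ h) v eq = branch-++ ts e e x h v eq

  branch-++ (t ∷ ts) [] e x h v eq = lookupTree-++ t (e ++ x ∷ []) h v eq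
  branch-++ (t ∷ ts) (y ∷ ys) e x h v eq with x ≡ᵇ y
  ... | true = lookupTree-++ t e h v eq
  ... | false = branch-++ ts ys e x h v eq

  lookupTree≤722 : ∀ t e h {n} → lookupTree t e h ≡ just n → n ≤ 722
  branch≤722 : ∀ ts ys e x h {n} → branch ts ys e x h ≡ just n → n ≤ 722

  lookupTree≤722 (leaf d) e h refl = m∸n≤m 722 d
  lookupTree≤722 (node ts) e (x ∷ h) eq = branch≤722 ts e e x h eq

  branch≤722 (t ∷ ts) [] e x h eq = lookupTree≤722 t (e ++ x ∷ []) h eq
  branch≤722 (t ∷ ts) (y ∷ ys) e x h eq with x ≡ᵇ y
  ... | true = lookupTree≤722 t e h eq
  ... | false = branch≤722 ts ys e x h eq

  match-++ : ∀ n h g v w → match n h g ≢ open-ended → match n (h ++ v) (g ++ w) ≡ match n h g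
  match-++ zero h g v w ≢open = refl
  match-++ (suc n) [] g v w ≢open = contradiction refl ≢open
  match-++ (suc n) (x ∷ h) [] v w ≢open = contradiction refl ≢open
  match-++ (suc n) (x ∷ h) (y ∷ g) v w ≢open with x ≡ᵇ y
  ... | true = match-++ n h g v w ≢open
  ... | false = refl

  drop-++ : ∀ n (h v : List ℕ) → ∃[ w ] drop n (h ++ v) ≡ drop n h ++ w
  drop-++ zero h v = v , refl
  drop-++ (suc n) [] v = drop (suc n) v , refl
  drop-++ (suc n) (x ∷ h) v = drop-++ n h v

  screen-++ : ∀ f ps h v {n} → (f h ≡ just n → f (h ++ v) ≡ just n) →
              screen f ps h ≡ just n → screen f ps (h ++ v) ≡ just n
  screen-++ f [] h v f-++ eq = f-++ eq
  screen-++ f (p ∷ ps) h v f-++ eq with drop-++ (suc p) h v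
  ... | w , drop-eq rewrite drop-eq with match p h (drop (suc p) h) | match-++ p h (drop (suc p) h) v w
  ...   | agree | same rewrite same (λ ()) = eq
  ...   | differ | same rewrite same (λ ()) = screen-++ f ps h v f-++ eq

  screen≤722 : ∀ f ps h {n} → (∀ {n} → f h ≡ just n → n ≤ 722) → screen f ps h ≡ just n → n ≤ 722
  screen≤722 f [] h f≤ eq = f≤ eq
  screen≤722 f (p ∷ ps) h f≤ eq with match p h (drop (suc p) h)
  screen≤722 f (p ∷ ps) h f≤ refl | agree = z≤n
  ... | differ = screen≤722 f ps h f≤ eq

  screen-disagree : ∀ f ps h {n} → screen f ps h ≡ just (suc n) →
                    All (λ p → match p h (drop (suc p) h) ≢ agree) ps
  screen-disagree f [] h eq = []
  screen-disagree f (p ∷ ps) h eq with match p h (drop (suc p) h) in verdict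
  ... | differ = (λ agrees → contradiction (trans (sym verdict) agrees) (λ ())) ∷ screen-disagree f ps h eq

  -- Transpositions of letters.

  swap : ℕ → ℕ → ℕ → ℕ
  swap i j n with n ≟ i | n ≟ j
  ... | yes _ | _ = j
  ... | no _ | yes _ = i
  ... | no _ | no _ = n

  swap-left : ∀ i j → swap i j i ≡ j
  swap-left i j with i ≟ i | i ≟ j
  ... | yes _ | _ = refl
  ... | no i≢i | _ = contradiction refl i≢i

  swap-right : ∀ i j → swap i j j ≡ i
  swap-right i j with j ≟ i | j ≟ j
  ... | yes j≡i | _ = j≡i
  ... | no _ | yes _ = refl
  ... | no _ | no j≢j = contradiction refl j≢j

  swap-fix : ∀ {i j n} → n ≢ i → n ≢ j → swap i j n ≡ n
  swap-fix {i} {j} {n} n≢i n≢j with n ≟ i | n ≟ j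
  ... | yes n≡i | _ = contradiction n≡i n≢i
  ... | no _ | yes n≡j = contradiction n≡j n≢j
  ... | no _ | no _ = refl

  swap-involutive : ∀ i j n → swap i j (swap i j n) ≡ n
  swap-involutive i j n with n ≟ i | n ≟ j
  ... | yes refl | _ = swap-right i j
  ... | no _ | yes refl = swap-left i j
  ... | no n≢i | no n≢j = swap-fix n≢i n≢j

  swap-< : ∀ {i j n k} → i < k → j < k → n < k → swap i j n < k
  swap-< {i} {j} {n} i<k j<k n<k with n ≟ i | n ≟ j
  ... | yes _ | _ = j<k
  ... | no _ | yes _ = i<k
  ... | no _ | no _ = n<k

  gaps : List ℕ
  gaps = 1 ∷ 2 ∷ 3 ∷ 4 ∷ 5 ∷ 6 ∷ []

  -- The finite search and its soundness.

  module Capacity (tree : Tree) where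

    partial : List ℕ → Maybe ℕ
    partial h = screen (lookupTree tree []) gaps h

    -- Undecided words count as 0, so a truncated history gives a lower bound.
    capacity : List ℕ → ℕ
    capacity h = fromMaybe 0 (partial h)

    isZero : Maybe ℕ → Bool
    isZero (just 0) = true
    isZero _ = false

    -- Histories in which an earlier position already had capacity 0 never occur in play.
    dead : List ℕ → Bool
    dead [] = false
    dead (a ∷ []) = isZero (partial (a ∷ []))
    dead (a ∷ b ∷ h) = isZero (partial (a ∷ b ∷ h)) ∨ dead h

    -- Meant for words starting with 0, Ann's last letter; hence the answers tried are 1, 2, 3.
    enough : Maybe ℕ → ℕ → List ℕ → Bool
    enough nothing b h = false
    enough (just c) b h =
      (3 * c + 720) ≤ᵇ 2 * (capacity (1 ∷ b ∷ h) + (capacity (2 ∷ b ∷ h) + (capacity (3 ∷ b ∷ h) + 0)))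

    locally : List ℕ → Bool
    locally h = dead h ∨ (enough c 0 h ∧ enough c 1 h ∧ enough c 2 h ∧ enough c 3 h)
      where c = partial h

    -- explore n k u: the word u uses exactly the letters below k; if its letters do not decide
    -- the capacity inequality, then it is extended into the past by one letter, up to n times.
    explore : ℕ → ℕ → List ℕ → Bool
    children : ℕ → ℕ → ℕ → List ℕ → Bool

    explore zero k u = false
    explore (suc n) k u = locally u ∨ children n 4 k u

    children n zero k u = true
    -- Letters above `k` are skipped: by symmetry a new letter may be taken to be `k`.
    children n (suc i) k u = ((k <ᵇ i) ∨ explore n (if i ≡ᵇ k then suc k else k) (u ++ i ∷ [])) ∧ children n i k u

    partial-map : ∀ {ρ} → Injective _≡_ _≡_ ρ → ∀ h → partial (map ρ h) ≡ partial h
    partial-map inj h = screen-map inj (lookupTree tree []) gaps h (lookupTree-map inj tree [] h)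

    capacity-map : ∀ {ρ} → Injective _≡_ _≡_ ρ → ∀ h → capacity (map ρ h) ≡ capacity h
    capacity-map inj h = cong (fromMaybe 0) (partial-map inj h)

    dead-map : ∀ {ρ} → Injective _≡_ _≡_ ρ → ∀ h → dead (map ρ h) ≡ dead h
    dead-map inj [] = refl
    dead-map inj (a ∷ []) = cong isZero (partial-map inj (a ∷ []))
    dead-map inj (a ∷ b ∷ h) = cong₂ _∨_ (cong isZero (partial-map inj (a ∷ b ∷ h))) (dead-map inj h)

    partial-++ : ∀ h v {n} → partial h ≡ just n → partial (h ++ v) ≡ just n
    partial-++ h v = screen-++ (lookupTree tree []) gaps h v (lookupTree-++ tree [] h v)

    capacity-++ : ∀ h v → capacity h ≤ capacity (h ++ v)
    capacity-++ h v with partial h in eq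
    ... | nothing = z≤n
    ... | just n rewrite partial-++ h v eq = ≤-refl

    isZero-++ : ∀ h v → T (isZero (partial h)) → T (isZero (partial (h ++ v)))
    isZero-++ h v t with partial h in eq
    ... | just 0 rewrite partial-++ h v eq = tt

    dead-++ : ∀ h v → T (dead h) → T (dead (h ++ v))
    dead-++ (a ∷ []) [] t = t
    dead-++ (a ∷ []) v@(_ ∷ _) t = Equivalence.from T-∨ (inj₁ (isZero-++ (a ∷ []) v t))
    dead-++ (a ∷ b ∷ h) v t with Equivalence.to T-∨ t
    ... | inj₁ z = Equivalence.from T-∨ (inj₁ (isZero-++ (a ∷ b ∷ h) v z))
    ... | inj₂ d = Equivalence.from T-∨ (inj₂ (dead-++ h v d))

    capacity≤722 : ∀ h → capacity h ≤ 722
    capacity≤722 h with partial h in eq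
    ... | nothing = z≤n
    ... | just n = screen≤722 (lookupTree tree []) gaps h (lookupTree≤722 tree [] h) eq

    capacity-disagree : ∀ h → 0 < capacity h → All (λ p → match p h (drop (suc p) h) ≢ agree) gaps
    capacity-disagree h pos with partial h in eq
    ... | just (suc n) = screen-disagree (lookupTree tree []) gaps h eq

    -- `head h` is Ann's last letter, excluded so that `threat-drift` applies to the options.
    record Supply (b : ℕ) (h : List ℕ) : Set where
      field
        options : List ℕ
        small : All (_< 4) options
        unique : Unique options
        ≢head : All (λ a → head h ≢ just a) options
        supply : 3 * capacity h + 720 ≤ 2 * sum (map (λ a → capacity (a ∷ b ∷ h)) options)

    Supplied : List ℕ → Set
    Supplied h = ¬ T (dead h) → ∀ b → b < 4 → Supply b h

    supplied-map : ∀ {ρ} → (∀ n → ρ (ρ n) ≡ n) → (∀ {n} → n < 4 → ρ n < 4) →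
                   ∀ h → Supplied (map ρ h) → Supplied h
    supplied-map {ρ} involutive ρ< h s alive b b<4 = record
      { options = map ρ options
      ; small = All.map⁺ (All.map ρ< small)
      ; unique = Unique.map⁺ inj unique
      ; ≢head = All.map⁺ (All.map (λ ≢ eq → ≢ (head-map eq)) ≢head)
      ; supply = subst₂ (λ c l → 3 * c + 720 ≤ 2 * sum l) (capacity-map inj h) sums supply
      }
      where
      inj : Injective _≡_ _≡_ ρ
      inj {x} {y} eq = trans (sym (involutive x)) (trans (cong ρ eq) (involutive y))

      open Supply (s (alive ∘ subst T (dead-map inj h)) (ρ b) (ρ< b<4))

      head-map : ∀ {a} → head h ≡ just (ρ a) → head (map ρ h) ≡ just a
      head-map {a} eq = trans (lemma h) (trans (cong (Maybe.map ρ) eq) (cong just (involutive a)))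
        where
        lemma : ∀ l → head (map ρ l) ≡ Maybe.map ρ (head l)
        lemma [] = refl
        lemma (_ ∷ _) = refl

      sums : map (λ a → capacity (a ∷ ρ b ∷ map ρ h)) options ≡ map (λ a → capacity (a ∷ b ∷ h)) (map ρ options)
      sums = trans (map-cong (λ a → trans (cong (λ a′ → capacity (a′ ∷ ρ b ∷ map ρ h)) (sym (involutive a)))
                                          (capacity-map inj (ρ a ∷ b ∷ h))) options)
                   (map-∘ options)

    -- Older letters keep the decided capacity of `0 ∷ u` and can only raise those after an answer.
    enough-sound : ∀ b u v → T (enough (partial (0 ∷ u)) b (0 ∷ u)) → Supply b (0 ∷ u ++ v)
    enough-sound b u v t with partial (0 ∷ u) in eq
    ... | just c = record
      { options = 1 ∷ 2 ∷ 3 ∷ []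
      ; small = s≤s (s≤s z≤n) ∷ s≤s (s≤s (s≤s z≤n)) ∷ s≤s (s≤s (s≤s (s≤s z≤n))) ∷ []
      ; unique = ((λ ()) ∷ (λ ()) ∷ []) ∷ ((λ ()) ∷ []) ∷ [] ∷ []
      ; ≢head = (λ ()) ∷ (λ ()) ∷ (λ ()) ∷ []
      ; supply = subst (λ c′ → 3 * c′ + 720 ≤ _) (cong (fromMaybe 0) (sym (partial-++ (0 ∷ u) v eq)))
          (≤-trans (≤ᵇ⇒≤ _ _ t) (*-monoʳ-≤ 2 (+-mono-≤ (grow 1) (+-mono-≤ (grow 2) (+-mono-≤ (grow 3) z≤n)))))
      }
      where
      grow : ∀ a → capacity (a ∷ b ∷ 0 ∷ u) ≤ capacity (a ∷ b ∷ 0 ∷ u ++ v)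
      grow a = capacity-++ (a ∷ b ∷ 0 ∷ u) v

    locally-sound : ∀ u v → T (locally (0 ∷ u)) → Supplied (0 ∷ u ++ v)
    locally-sound u v t alive with Equivalence.to T-∨ t
    ... | inj₁ d = contradiction (dead-++ (0 ∷ u) v d) alive
    ... | inj₂ es with Equivalence.to T-∧ es
    ...   | e₀ , es₁ with Equivalence.to T-∧ es₁
    ...     | e₁ , es₂ with Equivalence.to T-∧ es₂
    ...       | e₂ , e₃ = λ where
      0 _ → enough-sound 0 u v e₀
      1 _ → enough-sound 1 u v e₁
      2 _ → enough-sound 2 u v e₂
      3 _ → enough-sound 3 u v e₃
      (suc (suc (suc (suc _)))) (s≤s (s≤s (s≤s (s≤s ()))))

    children-sound : ∀ n j k u → T (children n j k u) → ∀ {i} → i < j → i ≤ k →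
                     T (explore n (if i ≡ᵇ k then suc k else k) (u ++ i ∷ []))
    children-sound n (suc j) k u t {i} (s≤s i≤j) i≤k with Equivalence.to T-∧ t
    ... | first , rest with i ≟ j
    ...   | no i≢j = children-sound n j k u rest (≤∧≢⇒< i≤j i≢j) i≤k
    ...   | yes refl with Equivalence.to T-∨ first
    ...     | inj₁ k<i = contradiction (<ᵇ⇒< k i k<i) (≤⇒≯ i≤k)
    ...     | inj₂ found = found

    -- `v` provides the letters that the search asks for. A letter not below `k` is exchanged with
    -- `k`, which leaves `0 ∷ u` fixed.
    explore-sound : ∀ n k u → All (_< k) (0 ∷ u) → T (explore n k (0 ∷ u)) →
                    ∀ v → All (_< 4) v → n ≤ length v → Supplied (0 ∷ u ++ v)
    explore-sound (suc n) k u u<k t (y ∷ v) (y<4 ∷ v<4) (s≤s n≤) with Equivalence.to T-∨ t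
    ... | inj₁ l = locally-sound u (y ∷ v) l
    ... | inj₂ c with y <? k
    ...   | yes y<k =
      subst (Supplied ∘ (0 ∷_)) (++-assoc u (y ∷ []) v)
        (explore-sound n k (u ++ y ∷ []) (All.++⁺ u<k (y<k ∷ []))
          (subst (λ k′ → T (explore n k′ (0 ∷ u ++ y ∷ [])))
            (cong (if_then suc k else k) (dec-false (y ≟ k) (<⇒≢ y<k)))
            (children-sound n 4 k (0 ∷ u) c y<4 (<⇒≤ y<k)))
          v v<4 n≤)
    ...   | no y≮k =
      supplied-map (swap-involutive y k) (swap-< y<4 k<4) (0 ∷ u ++ y ∷ v)
        (subst Supplied rename
          (explore-sound n (suc k) (u ++ k ∷ []) (All.++⁺ (All.map m<n⇒m<1+n u<k) (n<1+n k ∷ []))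
            (subst (λ k′ → T (explore n k′ (0 ∷ u ++ k ∷ [])))
              (cong (if_then suc k else k) (dec-true (k ≟ k) refl))
              (children-sound n 4 k (0 ∷ u) c k<4 ≤-refl))
            (map (swap y k) v) (All.map⁺ (All.map (swap-< y<4 k<4) v<4))
            (subst (n ≤_) (sym (length-map (swap y k) v)) n≤)))
      where
      k<4 : k < 4
      k<4 = ≤-<-trans (≮⇒≥ y≮k) y<4

      fixed : map (swap y k) (0 ∷ u) ≡ 0 ∷ u
      fixed = map-id-local (All.map (λ x<k → swap-fix (λ x≡y → y≮k (subst (_< k) x≡y x<k)) (<⇒≢ x<k)) u<k)

      rename : (0 ∷ u ++ k ∷ []) ++ map (swap y k) v ≡ map (swap y k) (0 ∷ u ++ y ∷ v)
      rename = sym (begin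
        map (swap y k) (0 ∷ u ++ y ∷ v) ≡⟨ map-++ (swap y k) (0 ∷ u) (y ∷ v) ⟩
        map (swap y k) (0 ∷ u) ++ swap y k y ∷ map (swap y k) v ≡⟨ cong₂ _++_ fixed (cong (_∷ map (swap y k) v) (swap-left y k)) ⟩
        (0 ∷ u) ++ k ∷ map (swap y k) v ≡⟨ ++-assoc (0 ∷ u) (k ∷ []) (map (swap y k) v) ⟨
        (0 ∷ u ++ k ∷ []) ++ map (swap y k) v ∎)
        where open ≡-Reasoning

    supplied : ∀ n → explore n 1 (0 ∷ []) ≡ true → ∀ h → All (_< 4) h → n < length h → Supplied h
    supplied n explored (x ∷ h) (x<4 ∷ h<4) (s≤s n≤) =
      supplied-map (swap-involutive x 0) (swap-< x<4 (s≤s z≤n)) (x ∷ h)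
        (subst (λ x′ → Supplied (x′ ∷ map (swap x 0) h)) (sym (swap-left x 0))
          (explore-sound n 1 [] (s≤s z≤n ∷ []) (subst T (sym explored) tt) (map (swap x 0) h)
            (All.map⁺ (All.map (swap-< x<4 (s≤s z≤n)) h<4))
            (subst (n ≤_) (sym (length-map (swap x 0) h)) n≤)))

-- The concrete tree and its verification.

module Invariant where

  open Threat
  open Certificate
  open import Data.Rational using (ℚ; 0ℚ; 1ℚ; ½; _/_; _+_; _*_; _≤_; _<_)
  open import Data.Rational.Properties
  open import Data.Rational.Solver using (module +-*-Solver)
  open +-*-Solver using (solve; _:=_; _:+_; _:*_; con)

  pattern node₁ s = node (s ∷ [])
  pattern node₂ s t = node (s ∷ t ∷ [])
  pattern node₃ s t u = node (s ∷ t ∷ u ∷ [])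
  pattern node₄ s t u v = node (s ∷ t ∷ u ∷ v ∷ [])
  -- The capacities 722, 509, 402, 241. In the inequality of `Supply`, two answers of capacity 722
  -- carry 722; one alone carries at most 241; 722 + 241 carries at most 402; 722 + 402 at most 509.
  pattern ● = leaf 0
  pattern ◑ = leaf 213
  pattern ◕ = leaf 320
  pattern ◔ = leaf 481

  -- Derived from the greatest solution of the inequality in Supply for the game in which only
  -- the periods up to 7 are forbidden, lowering some values to merge branches.
  tree : Tree
  tree =
    node₁
      (node₂
        (node₂
          ●
          (node₃
            (node₃ ● ● (node₄ ● ● (node₄ ◕ ● ● ●) (node₄ ◕ ● ● ●)))
            (node₃
              (node₃
                ● ●
                (node₄
                  ●
                  (node₄ ◔ ● ● ●)
                  (node₄ (node₄ ◕ ● ● ●) ● ● ●)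
                  (node₄ (node₄ ◕ ● ● ●) ● ● ●)))
              ●
              (node₄
                (node₄ ◑ ● ● ●)
                ●
                (node₄
                  (node₄ (node₄ ● ◕ ◑ ◑) ◑ ◑ ◑)
                  ● ●
                  (node₄ (node₄ (node₄ ● (node₄ ● ◕ ● ●) ● ●) ● ● ●) ● ● ●))
                (node₄
                  (node₄ (node₄ ● ◕ ● ●) ● ● ●)
                  ● ●
                  (node₄ (node₄ (node₄ ◑ (node₄ ● ◕ ◑ ◑) ◑ ◑) ● ● ●) ● ● ●))))
            (node₄
              (node₄
                ● ●
                (node₄
                  ● ●
                  (node₄ (node₄ (node₄ ● (node₄ ● ● ◔ ●) ● ●) ● ● ●) ● ● ●)
                  (node₄ (node₄ ◕ ● ● ●) ● ● ●))
                (node₄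
                  ● ●
                  (node₄ (node₄ (node₄ ● (node₄ ● ● ◔ ●) ● ●) ● ● ●) ● ● ●)
                  (node₄ (node₄ (node₄ ● ◕ ● ●) ● ● ●) ● ● ●)))
              ●
              (node₄
                (node₄ ◕ ● ● ●)
                ●
                (node₄ (node₄ ◕ ● ● ●) ● ● (node₄ (node₄ ◕ ● ● ●) ● ● ●))
                (node₄ (node₄ ◕ ● ● ●) ● ● (node₄ (node₄ ◕ ● ● ●) ● ● ●)))
              (node₄
                (node₄ ◕ ● ● ●)
                ●
                (node₄ (node₄ ◕ ● ● ●) ● (node₄ (node₄ ◕ ● ● ●) ● ● ●) ●)
                (node₄ (node₄ ◔ (leaf 94) (leaf 94) (leaf 94)) ● (node₄ (node₄ ◕ ● ● ●) ● ● ●) ●)))))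
        (node₃
          ●
          (node₃
            (node₃ (node₃ ● ● (node₄ ● ◑ ● ●)) ● ●)
            (node₃ ● ● (node₄ ● (node₄ ◔ ● ● ●) ● ●))
            (node₄
              (node₄
                (node₄ ● ◔ ● ●)
                ●
                (node₄ ● ● (node₄ ◔ ● ● ●) (node₄ ◔ ● ● ●))
                (node₄ ● ● (node₄ ◔ ● ● ●) (node₄ ◔ ● ● ●)))
              ●
              (node₄ ● (node₄ (node₄ ● ◔ ● ●) ● ● ●) ● ●)
              (node₄ ● (node₄ (node₄ ● ◔ ● ●) ● ● ●) ● ●)))
          (node₄
            (node₄ (node₄ ● ● ● (node₄ ● ● ◕ ●)) ● ● ●)
            (node₄
              (node₄ ● ● ● (node₄ ● ● ◕ ●))
              (node₄ ● ● (node₄ ● ● (node₄ (node₄ ● ◕ ● ●) ● ● ●) ●) ●)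
              ●
              (node₄ ● ● ◔ ●))
            (node₄
              (node₄
                ◔ ◔ ◔
                (node₄ ● ◔ (node₄ (node₄ ◔ (node₄ ◔ ◔ (node₄ ● ● (leaf 722) ◔) ◔) ● ●) ◔ ◔ ◔) ◔))
              (node₄ ● ● ● (node₄ ● ● (node₄ ◔ ● ● ●) ●))
              ●
              (node₄
                (node₄ ● (leaf 62) ● ●)
                ●
                (node₄ (node₄ ● (node₄ ● ● ◔ ●) ● ●) ● ● ●)
                (node₄ ● ● (node₄ (node₄ ● (node₄ ● ● (node₄ ● ● ◔ ●) ●) ● ●) ● ● ●) ●)))
            (node₄
              (node₄ ● ● (node₄ ● ● (node₄ ◔ ● ● ●) ●) (node₄ ● ● ◔ (node₄ ◔ ● ● ●)))
              (node₄
                ● ●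
                (node₄ ● ● (node₄ (node₄ ● ◔ ● ●) ● ● ●) ●)
                (node₄ ● ● (node₄ (node₄ ● ◔ ● ●) ● ● ●) ●))
              ●
              (node₄
                ● ●
                (node₄ (node₄ ● (node₄ ● ● ◔ ●) ● ●) ● (node₄ ◔ ● ● ●) ●)
                (node₄ ● ● ◔ ●))))))

  open Capacity tree

  -- Checked by evaluation: every branch of the search is settled by a word of at most 13 letters.
  explored : explore 13 1 (0 ∷ []) ≡ true
  explored = refl

  all-supplied : ∀ h → All (ℕ._< 4) h → 13 ℕ.< length h → Supplied h
  all-supplied = supplied 13 explored

  -- Ann's good answer, by averaging.

  fromℕ : ℕ → ℚ
  fromℕ zero = 0ℚ
  fromℕ (suc n) = 1ℚ + fromℕ n

  fromℕ-+ : ∀ m n → fromℕ (m ℕ.+ n) ≡ fromℕ m + fromℕ n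
  fromℕ-+ zero n = sym (+-identityˡ (fromℕ n))
  fromℕ-+ (suc m) n = trans (cong (1ℚ +_) (fromℕ-+ m n)) (sym (+-assoc 1ℚ (fromℕ m) (fromℕ n)))

  fromℕ≥0 : ∀ n → 0ℚ ≤ fromℕ n
  fromℕ≥0 zero = ≤-refl
  fromℕ≥0 (suc n) = +-≥0 (from-yes (0ℚ ≤? 1ℚ)) (fromℕ≥0 n)

  fromℕ-mono : ∀ {m n} → m ℕ.≤ n → fromℕ m ≤ fromℕ n
  fromℕ-mono {n = n} z≤n = fromℕ≥0 n
  fromℕ-mono (s≤s m≤n) = +-monoʳ-≤ 1ℚ (fromℕ-mono m≤n)

  total-fromℕ : ∀ as (f : ℕ → ℕ) → total as (λ a → fromℕ (f a)) ≡ fromℕ (sum (map f as))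
  total-fromℕ [] f = refl
  total-fromℕ (a ∷ as) f = trans (cong (fromℕ (f a) +_) (total-fromℕ as f)) (sym (fromℕ-+ (f a) (sum (map f as))))

  total-<⇒∃ : ∀ as f g → total as f < total as g → ∃[ a ] a ∈ as × f a < g a
  total-<⇒∃ [] f g lt = contradiction lt (<-irrefl refl)
  total-<⇒∃ (a ∷ as) f g lt with f a <? g a
  ... | yes fa<ga = a , here refl , fa<ga
  ... | no fa≮ga with total as f <? total as g
  ...   | yes lt′ = let a′ , a′∈ , lt″ = total-<⇒∃ as f g lt′ in a′ , there a′∈ , lt″
  ...   | no ≮ = contradiction (<-≤-trans lt (+-mono-≤ (≮⇒≥ fa≮ga) (≮⇒≥ ≮))) (<-irrefl refl)

  -- The invariant after each move of Ann. Being strict, it forces a positive capacity.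
  Winning : List ℕ → Set
  Winning h = threat h < fromℕ (capacity h)

  3/2-supply : ∀ c l → 3 ℕ.* c ℕ.+ 720 ℕ.≤ 2 ℕ.* l → 1½ * fromℕ c + (ℤ.+ 360 / 1) ≤ fromℕ l
  3/2-supply c l le = subst₂ _≤_ left right (*-monoˡ-≤-nonNeg ½ (fromℕ-mono le))
    where
    c′ = fromℕ c
    l′ = fromℕ l
    left : ½ * fromℕ (3 ℕ.* c ℕ.+ 720) ≡ 1½ * c′ + (ℤ.+ 360 / 1)
    left rewrite fromℕ-+ (3 ℕ.* c) 720 | fromℕ-+ c (c ℕ.+ (c ℕ.+ 0)) | fromℕ-+ c (c ℕ.+ 0) | fromℕ-+ c 0 =
      solve 1 (λ x → con ½ :* ((x :+ (x :+ (x :+ con 0ℚ))) :+ con (ℤ.+ 720 / 1)) := con 1½ :* x :+ con (ℤ.+ 360 / 1)) refl c′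
    right : ½ * fromℕ (2 ℕ.* l) ≡ l′
    right rewrite fromℕ-+ l (l ℕ.+ 0) | fromℕ-+ l 0 =
      solve 1 (λ x → con ½ :* (x :+ (x :+ con 0ℚ)) := x) refl l′

  -- Summed over the options, the threats stay strictly below the capacities, so some option has
  -- threat below capacity.
  answer : ∀ b h → All (ℕ._< 4) h → 13 ℕ.< length h → ¬ T (dead h) → Winning h → b ℕ.< 4 →
           ∃[ a ] a ℕ.< 4 × Winning (a ∷ b ∷ h)
  answer b (c ∷ h) h<4 long alive win b<4 =
    let a , a∈ , a-wins = total-<⇒∃ options (λ a → threat (ext a)) (λ a → fromℕ (capacity (ext a))) less
    in a , All.lookup small a∈ , a-wins
    where
    open Supply (all-supplied (c ∷ h) h<4 long alive b b<4)
    open ≤-Reasoning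
    ext : ℕ → List ℕ
    ext a = a ∷ b ∷ c ∷ h
    less : total options (λ a → threat (ext a)) < total options (λ a → fromℕ (capacity (ext a)))
    less = begin-strict
      total options (λ a → threat (ext a))
        ≤⟨ threat-drift b c h (λ c∈ → All.lookup ≢head c∈ refl) unique ⟩
      1½ * threat (c ∷ h) + (ℤ.+ 360 / 1)
        <⟨ +-monoˡ-< (ℤ.+ 360 / 1) (*-monoʳ-<-pos 1½ win) ⟩
      1½ * fromℕ (capacity (c ∷ h)) + (ℤ.+ 360 / 1)
        ≤⟨ 3/2-supply (capacity (c ∷ h)) (sum (map (λ a → capacity (ext a)) options)) supply ⟩
      fromℕ (sum (map (λ a → capacity (ext a)) options))
        ≡⟨ total-fromℕ options (λ a → capacity (ext a)) ⟨
      total options (λ a → fromℕ (capacity (ext a))) ∎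

  -- Violated periods contradict the invariant.

  winning⇒capacity : ∀ h → Winning h → 0 ℕ.< capacity h
  winning⇒capacity h win with capacity h
  ... | zero = contradiction (<-≤-trans win (dangers≥0 0 h (drop 8 h))) (<-irrefl refl)
  ... | suc _ = s≤s z≤n

  drop-length-++ : ∀ (q : List ℕ) s → drop (length q) (q ++ s) ≡ s
  drop-length-++ [] s = refl
  drop-length-++ (_ ∷ q) s = drop-length-++ q s

  match-agree : ∀ q s x → match (length q) (q ++ s) (q ++ x) ≡ agree
  match-agree [] s x = refl
  match-agree (y ∷ q) s x rewrite dec-true (y ℕ.≟ y) refl = match-agree q s x

  run-≥ : ∀ q s x → ⌊ length q ℕ.∸ 1 /2⌋ ℕ.≤ run (q ++ s) (q ++ x)
  run-≥ [] s x = z≤n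
  run-≥ (_ ∷ []) s x = z≤n
  run-≥ (_ ∷ _ ∷ []) s x = z≤n
  run-≥ (a ∷ b ∷ c ∷ q) s x = subst (suc ⌊ length q /2⌋ ℕ.≤_) (sym (run-hit a b c (q ++ s) (q ++ x)))
    (s≤s (run-≥ (c ∷ q) s x))

  short-period : ∀ {m} h → 0 ℕ.< capacity h → 0 ℕ.< m → m ℕ.≤ 6 → match m h (drop (suc m) h) ≢ agree
  short-period h pos 0<m m≤6 with capacity-disagree h pos | m≤6
  ... | _ ∷ _ | z≤n = contradiction 0<m (λ ())
  ... | d ∷ _ | s≤s z≤n = d
  ... | _ ∷ d ∷ _ | s≤s (s≤s z≤n) = d
  ... | _ ∷ _ ∷ d ∷ _ | s≤s (s≤s (s≤s z≤n)) = d
  ... | _ ∷ _ ∷ _ ∷ d ∷ _ | s≤s (s≤s (s≤s (s≤s z≤n))) = d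
  ... | _ ∷ _ ∷ _ ∷ _ ∷ d ∷ _ | s≤s (s≤s (s≤s (s≤s (s≤s z≤n)))) = d
  ... | _ ∷ _ ∷ _ ∷ _ ∷ _ ∷ d ∷ _ | s≤s (s≤s (s≤s (s≤s (s≤s (s≤s z≤n))))) = d

  -- The violated period is `length q + 1`. Up to 7 it makes the capacity 0; from 8 on its danger
  -- alone reaches 722, which no capacity exceeds.
  no-almost-square : ∀ q z x → 0 ℕ.< length q → ¬ Winning (q ++ z ∷ q ++ x)
  no-almost-square q z x 0<q win with length q ℕ.≤? 6
  ... | yes q≤6 = short-period h (winning⇒capacity h win) 0<q q≤6
    (subst (λ g → match (length q) h g ≡ agree) (sym shifted) (match-agree q (z ∷ q ++ x) x))
    where
    h = q ++ z ∷ q ++ x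
    shifted : drop (suc (length q)) h ≡ q ++ x
    shifted = trans (cong (λ n → drop n h) (ℕ.+-comm 1 (length q)))
      (trans (sym (drop-drop (length q) 1 h)) (cong (drop 1) (drop-length-++ q (z ∷ q ++ x))))
  ... | no q≰6 = <-irrefl refl (begin-strict
    threat h <⟨ win ⟩
    fromℕ (capacity h) ≤⟨ fromℕ-mono (capacity≤722 h) ⟩
    fromℕ 722 ≤⟨ danger-complete n ⟩
    danger n (3 ℕ.+ ⌊ n /2⌋) ≤⟨ danger-mono n long-run ⟩
    danger n (run h (drop n (drop 8 h))) ≡⟨ cong (λ m → danger m (run h (drop n (drop 8 h)))) (ℕ.+-identityʳ n) ⟨
    danger (n ℕ.+ 0) (run h (drop n (drop 8 h))) ≤⟨ danger≤dangers n 0 h (drop 8 h) ⟩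
    threat h ∎)
    where
    open ≤-Reasoning
    h = q ++ z ∷ q ++ x
    -- Chosen so that `n + 8` is the period `length q + 1`.
    n = length q ℕ.∸ 7
    length-q : 7 ℕ.+ n ≡ length q
    length-q = ℕ.m+[n∸m]≡n (ℕ.≰⇒> q≰6)
    shifted : drop n (drop 8 h) ≡ q ++ x
    shifted = trans (drop-drop 8 n h) (trans (cong (λ m → drop m h) (trans (cong suc length-q) (ℕ.+-comm 1 (length q))))
      (trans (sym (drop-drop (length q) 1 h)) (cong (drop 1) (drop-length-++ q (z ∷ q ++ x)))))
    long-run : 3 ℕ.+ ⌊ n /2⌋ ℕ.≤ run h (drop n (drop 8 h))
    long-run = subst₂ (λ m g → ⌊ m ℕ.∸ 1 /2⌋ ℕ.≤ run h g) (sym length-q) (sym shifted) (run-≥ q (z ∷ q ++ x) x)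

  -- Positions reached in play.

  -- A fictitious past (last letter first), long enough for all lookups to be decided.
  prelude : List ℕ
  prelude = 0 ∷ 0 ∷ 1 ∷ 0 ∷ 2 ∷ 0 ∷ 0 ∷ 0 ∷ 1 ∷ 1 ∷ 0 ∷ 0 ∷ 2 ∷ 0 ∷ 1 ∷ []

  data Play : List ℕ → Set where
    opening : Play prelude
    round   : ∀ {a b h} → Play h → b ℕ.< 4 → a ℕ.< 4 → Winning (a ∷ b ∷ h) → Play (a ∷ b ∷ h)

  play-winning : ∀ {h} → Play h → Winning h
  play-winning opening = from-yes (threat prelude <? fromℕ (capacity prelude))
  play-winning (round _ _ _ win) = win

  play-small : ∀ {h} → Play h → All (ℕ._< 4) h
  play-small opening = from-yes (All.all? (ℕ._<? 4) prelude)
  play-small (round p b<4 a<4 _) = a<4 ∷ b<4 ∷ play-small p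

  play-long : ∀ {h} → Play h → 13 ℕ.< length h
  play-long opening = from-yes (13 ℕ.<? 15)
  play-long (round p _ _ _) = ℕ.m≤n⇒m≤1+n (ℕ.m≤n⇒m≤1+n (play-long p))

  -- `dead` steps back by whole rounds, so beyond the prelude it meets only positions left by Ann,
  -- all of positive capacity.
  play-alive : ∀ {h} → Play h → ¬ T (dead h)
  play-alive opening = λ ()
  play-alive (round {a} {b} {h} p _ _ win) t with Equivalence.to T-∨ t
  ... | inj₂ d = play-alive p d
  ... | inj₁ z = contradiction (winning⇒capacity (a ∷ b ∷ h) win) (isZero⇒ (a ∷ b ∷ h) z)
    where
    isZero⇒ : ∀ g → T (isZero (partial g)) → ¬ (0 ℕ.< capacity g)
    isZero⇒ g z 0<c with partial g
    isZero⇒ g z () | just 0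

-- Ann's answers and the absence of squares.

open Threat using (threat)
open Invariant
open Certificate.Capacity tree using (capacity)
open import Data.Nat using (_≤_)
open import Data.Rational.Properties using (_<?_)

winning? : ∀ h → Dec (Winning h)
winning? h = threat h <? fromℕ (capacity h)

-- A strategy sees the word but no proof that a good answer exists, so it searches by deciding
-- `Winning`; 0 is a mere default.
choose : List ℕ → List ℕ → ℕ
choose [] h = 0
choose (a ∷ as) h with winning? (a ∷ h)
... | yes _ = a
... | no _ = choose as h

choose-wins : ∀ as h {a} → a ∈ as → Winning (a ∷ h) → choose as h ∈ as × Winning (choose as h ∷ h)
choose-wins (a ∷ as) h a∈ win with winning? (a ∷ h)
choose-wins (a ∷ as) h a∈ win | yes a-wins = here refl , a-wins
choose-wins (a ∷ as) h (here refl) win | no a-loses = contradiction win a-loses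
choose-wins (a ∷ as) h (there a∈) win | no _ = let c∈ , c-wins = choose-wins as h a∈ win in there c∈ , c-wins

respond : List ℕ → ℕ
respond = choose (upTo 4)

respond-plays : ∀ {b h} → Play h → b ℕ.< 4 → Play (respond (b ∷ h) ∷ b ∷ h)
respond-plays {b} {h} p b<4 =
  let a , a<4 , a-wins = answer b h (play-small p) (play-long p) (play-alive p) (play-winning p) b<4
      r∈ , r-wins = choose-wins (upTo 4) (b ∷ h) (∈-upTo⁺ a<4) a-wins
  in round p b<4 (∈-upTo⁻ r∈) r-wins

-- With `u` split as `q` followed by `z`, its square begins with `q z q`.
no-square-here : ∀ {h} → Winning h → ∀ u x → 2 ≤ length u → h ≢ u ++ u ++ x
no-square-here win u x 2≤u eq with initLast u
... | q ∷ʳ′ z = no-almost-square q z (z ∷ x)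
  (ℕ.≤-pred (subst (2 ≤_) (trans (length-++ q) (ℕ.+-comm (length q) 1)) 2≤u))
  (subst Winning (trans eq (trans (++-assoc q (z ∷ []) _) (cong (λ s → q ++ z ∷ s) (++-assoc q (z ∷ []) x)))) win)

-- Removing Ben's letter `b` from the square of `b q` leaves `q b q`, already excluded in Ann's
-- position.
no-square-after : ∀ {b h} → Winning h → ∀ u x → 2 ≤ length u → b ∷ h ≢ u ++ u ++ x
no-square-after win (b ∷ q) x (s≤s 1≤q) refl = no-almost-square q b x 1≤q win

-- Ann moves first, but the rounds of `Play` begin with Ben; the 0 is a fictitious move of his.
opened : List ℕ
opened = 0 ∷ prelude

-- Ending in `opened` confines the square to the letters really played. The later letters `s` are
-- stripped one by one until the square is completed by the last move.
play-square-free : ∀ {h} → Play h → ∀ s u x → 2 ≤ length u → h ≢ s ++ u ++ u ++ x ++ opened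
answered-square-free : ∀ {b h} → Play h → ∀ s u x → 2 ≤ length u → b ∷ h ≢ s ++ u ++ u ++ x ++ opened

play-square-free p [] u x 2≤u eq = no-square-here (play-winning p) u (x ++ opened) 2≤u eq
play-square-free (round p _ _ _) (_ ∷ s) u x 2≤u eq = answered-square-free p s u x 2≤u (∷-injectiveʳ eq)
play-square-free opening s@(_ ∷ _) u x 2≤u eq = ℕ.<-irrefl (cong length eq) (begin-strict
  length prelude <⟨ ℕ.n<1+n _ ⟩
  length opened ≤⟨ suffix x opened ⟩
  length (x ++ opened) ≤⟨ suffix u _ ⟩
  length (u ++ x ++ opened) ≤⟨ suffix u _ ⟩
  length (u ++ u ++ x ++ opened) ≤⟨ suffix s _ ⟩
  length (s ++ u ++ u ++ x ++ opened) ∎)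
  where
  open ℕ.≤-Reasoning
  suffix : ∀ (v w : List ℕ) → length w ≤ length (v ++ w)
  suffix v w = subst (length w ≤_) (sym (length-++ v)) (ℕ.m≤n+m (length w) (length v))

answered-square-free p [] u x 2≤u eq = no-square-after (play-winning p) u (x ++ opened) 2≤u eq
answered-square-free p (_ ∷ s) u x 2≤u eq = play-square-free p s u x 2≤u (∷-injectiveʳ eq)

-- Transfer to the game over `Fin k`.

module Game (k : ℕ) (4≤k : 4 ≤ k) where

  -- Merging all further letters into 0 preserves squares, and Ann never plays them.
  encode : Fin k → ℕ
  encode x with toℕ x ℕ.<? 4
  ... | yes _ = toℕ x
  ... | no _ = 0

  encode<4 : ∀ x → encode x ℕ.< 4
  encode<4 x with toℕ x ℕ.<? 4
  ... | yes x<4 = x<4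
  ... | no _ = s≤s z≤n

  decode : ℕ → Fin k
  decode n with n ℕ.<? 4
  ... | yes n<4 = fromℕ< (ℕ.<-≤-trans n<4 4≤k)
  ... | no _ = fromℕ< (ℕ.<-≤-trans (s≤s z≤n) 4≤k)

  encode-decode : ∀ {n} → n ℕ.< 4 → encode (decode n) ≡ n
  encode-decode {n} n<4 with n ℕ.<? 4
  ... | no n≮4 = contradiction n<4 n≮4
  ... | yes n<4′ with toℕ (fromℕ< (ℕ.<-≤-trans n<4′ 4≤k)) ℕ.<? 4
  ...   | yes _ = toℕ-fromℕ< _
  ...   | no ≮4 = contradiction (subst (ℕ._< 4) (sym (toℕ-fromℕ< _)) n<4) ≮4

  mirror : List (Fin k) → List ℕ
  mirror w = reverse (map encode w)

  history : List (Fin k) → List ℕ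
  history w = mirror w ++ opened

  history-∷ʳ : ∀ w x → history (w ++ x ∷ []) ≡ encode x ∷ history w
  history-∷ʳ w x = cong (_++ opened)
    (trans (cong reverse (map-++ encode w (x ∷ []))) (reverse-++ (map encode w) (encode x ∷ [])))

  strategy : AnnStrategy (Fin k)
  strategy w = decode (respond (history w))

  ben-turn : ∀ {w} → BenTurn strategy w → Play (history w)
  ann-turn : ∀ {w} → AnnTurn strategy w → ∃[ b ] ∃[ h ] history w ≡ b ∷ h × b ℕ.< 4 × Play h

  ann-turn start = 0 , prelude , refl , s≤s z≤n , opening
  ann-turn (benMove {w} t x) = encode x , history w , history-∷ʳ w x , encode<4 x , ben-turn t

  ben-turn (annMove {w} t) =
    let b , h , eq , b<4 , p = ann-turn t
        answered = subst (λ g → Play (respond g ∷ g)) (sym eq) (respond-plays p b<4)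
        -- The answer is below 4, so encoding the letter actually played gives it back.
        encoded = encode-decode (All.head (play-small answered))
    in subst Play (sym (trans (history-∷ʳ w (strategy w)) (cong (_∷ history w) encoded))) answered

  mirror-++ : ∀ v w → mirror (v ++ w) ≡ mirror w ++ mirror v
  mirror-++ v w = trans (cong reverse (map-++ encode v w)) (reverse-++ (map encode v) (map encode w))

  history-square : ∀ x u y → history (x ++ u ++ u ++ y) ≡ mirror y ++ mirror u ++ mirror u ++ mirror x ++ opened
  history-square x u y = begin
    mirror (x ++ u ++ u ++ y) ++ opened
      ≡⟨ cong (_++ opened) (mirror-++ x (u ++ u ++ y)) ⟩
    (mirror (u ++ u ++ y) ++ mirror x) ++ opened
      ≡⟨ ++-assoc (mirror (u ++ u ++ y)) (mirror x) opened ⟩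
    mirror (u ++ u ++ y) ++ mirror x ++ opened
      ≡⟨ cong (_++ mirror x ++ opened) (trans (mirror-++ u (u ++ y)) (cong (_++ mirror u) (mirror-++ u y))) ⟩
    ((mirror y ++ mirror u) ++ mirror u) ++ mirror x ++ opened
      ≡⟨ trans (++-assoc (mirror y ++ mirror u) (mirror u) _) (++-assoc (mirror y) (mirror u) _) ⟩
    mirror y ++ mirror u ++ mirror u ++ mirror x ++ opened ∎
    where open ≡-Reasoning

  mirror-length : ∀ w → length (mirror w) ≡ length w
  mirror-length w = trans (length-reverse (map encode w)) (length-map encode w)

  wins : ∀ w → Reachable strategy w → ¬ HasSquareFactor≥2 w
  wins w (inj₂ t) (x , u , y , 2≤u , refl) =
    play-square-free (ben-turn t) (mirror y) (mirror u) (mirror x)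
      (subst (2 ≤_) (sym (mirror-length u)) 2≤u) (history-square x u y)
  wins w (inj₁ t) (x , u , y , 2≤u , refl) =
    let b , h , eq , _ , p = ann-turn t in
    answered-square-free p (mirror y) (mirror u) (mirror x)
      (subst (2 ≤_) (sym (mirror-length u)) 2≤u) (trans (sym eq) (history-square x u y))

theorem1 : (k : ℕ) → 4 ≤ k → AnnWins (Fin k)
theorem1 k 4≤k = Game.strategy k 4≤k , Game.wins k 4≤k
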